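{- Let $S$ be a small set and let $S^*$ be the free monoid on $S$. Let $A$ be a free $S^*$-set, and suppose that $A$ is small and has at least two elements. Then the $\mathfrak{Small}$-ary double centralizer clone $(\Sigma^A)^{\perp\perp(\mathfrak{Small})}$ of $A$ is equal to the clone of $\mathfrak{Small}$-ary derived operations $\langle \Sigma^A\rangle$ of $A$, where $\Sigma$ is the signature consisting of a unary operation symbol $s$ for each $s\in S$.
   Context: Fix a Grothendieck universe $\mathfrak{Small}$, i.e. the set of all sets of rank less than a fixed inaccessible cardinal; its elements are called small sets. The free monoid $S^*$ consists of all finite (possibly empty) strings of elements of $S$ under concatenation, with the empty string as identity. An $S^*$-set is a set $A$ equipped with an associative, unital left action $S^*\times A\to A$, $(w,a)\mapsto wa$; an $S^*$-set homomorphism is a map preserving the actions. An $S^*$-set $A$ is free on a set $Z$ if it is equipped with a map $\eta:Z\to A$ such that for every $S^*$-set $B$ and every map $b:Z\to B$ there is a unique $S^*$-set homomorphism $\hat b:A\to B$ with $\hat b\circ\eta=b$ (equivalently, $A$ is isomorphic to $S^*\times Z$ with action $w(v,z)=(wv,z)$, with $\eta$ corresponding to $z\mapsto(e,z)$, $e$ the empty string). $A$ is free if it is free on some set $Z$. $\Sigma^A$ denotes the set of basic unary operations $a\mapsto sa$ on $A$ $(s\in S)$. A $\mathfrak{Small}$-ary operation on a set $A$ is a map $A^X \to A$ with $X$ a small set (its arity); nullary operations are allowed. A $\mathfrak{Small}$-ary clone on $A$ is a set $F$ of $\mathfrak{Small}$-ary operations on $A$ that contains all projections $\pi_x:A^X\to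 A$ ($X$ small, $x\in X$) and is such that for all small $X,Y$, every $f:A^Y\to A$ in $F$ and every family $g_y:A^X\to A$ $(y\in Y)$ in $F$, the composite $f\circ(g_y)_{y\in Y}:A^X\to A$ lies in $F$. The clone of $\mathfrak{Small}$-ary derived operations $\langle\Sigma^A\rangle$ is the smallest $\mathfrak{Small}$-ary clone on $A$ containing $\Sigma^A$. Operations $f:A^X\to A$ and $g:A^Y\to A$ commute, written $f\perp g$, if for every matrix $a=(a_{xy})\in A^{X\times Y}$ one has $g\bigl((f((a_{xy})_{x\in X}))_{y\in Y}\bigr)=f\bigl((g((a_{xy})_{y\in Y}))_{x\in X}\bigr)$. For a set $F$ of $\mathfrak{Small}$-ary operations on $A$, $F^{\perp(\mathfrak{Small})}$ is the set of all $\mathfrak{Small}$-ary operations $f$ on $A$ with $f\perp g$ for all $g\in F$, and $F^{\perp\perp(\mathfrak{Small})}$ is the result of applying $(-)^{\perp(\mathfrak{Small})}$ twice to $F$. -}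

module Defs where

open import Level using (Level; _⊔_) renaming (suc to lsuc)
open import Data.List.Base using (List; []; _++_; [_])
open import Data.Product.Base using (Σ-syntax; _×_)
open import Data.Unit.Polymorphic.Base using (⊤; tt)
open import Function.Base using (_∘_)
open import Function.Bundles using (Func)
open import Relation.Binary.PropositionalEquality
  using (_≡_; _≗_; cong; setoid; _→-setoid_)
open import Relation.Unary using (Pred; _⊆_; _≐_)

-- Throughout, Set ℓ plays the role of the Grothendieck universe of small sets.

record *-Set {ℓ : Level} (S : Set ℓ) : Set (lsuc ℓ) where
  infixr 6 _·_
  field
    Carrier  : Set ℓ
    _·_      : List S → Carrier → Carrier
    identity : ∀ a → [] · a ≡ a
    assoc    : ∀ v w a → (v ++ w) · a ≡ v · (w · a)

record Hom {ℓ : Level} {S : Set ℓ} (A B : *-Set S) : Set ℓ where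
  private
    module A = *-Set A
    module B = *-Set B
  field
    to       : A.Carrier → B.Carrier
    preserve : ∀ w a → to (w A.· a) ≡ w B.· to a

-- Testing only against small B loses nothing: the free *-set on a small Z,
-- namely List S × Z, is itself small.
IsFreeOn : {ℓ : Level} {S : Set ℓ} (A : *-Set S) (Z : Set ℓ) →
           (Z → *-Set.Carrier A) → Set (lsuc ℓ)
IsFreeOn {S = S} A Z η =
  (B : *-Set S) (b : Z → *-Set.Carrier B) →
  Σ[ b̂ ∈ Hom A B ]
    (Hom.to b̂ ∘ η ≗ b) ×
    (∀ (h : Hom A B) → Hom.to h ∘ η ≗ b → Hom.to h ≗ Hom.to b̂)

-- A basis of a small free *-set embeds in it, so it may be taken small.
IsFree : {ℓ : Level} {S : Set ℓ} → *-Set S → Set (lsuc ℓ)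
IsFree {ℓ} A = Σ[ Z ∈ Set ℓ ] Σ[ η ∈ (Z → *-Set.Carrier A) ] IsFreeOn A Z η

module _ {ℓ : Level} where

  -- Maps A^X → A.  Since function extensionality is not available, A^X is the
  -- setoid of functions under pointwise equality, which operations respect.
  Operation : Set ℓ → Set ℓ → Set ℓ
  Operation A X = Func (X →-setoid A) (setoid A)

  infixl 9 _⟨_⟩
  _⟨_⟩ : {A X : Set ℓ} → Operation A X → (X → A) → A
  f ⟨ a ⟩ = Func.to f a

  infix 4 _≈_
  _≈_ : {A X : Set ℓ} → Operation A X → Operation A X → Set ℓ
  f ≈ g = ∀ a → f ⟨ a ⟩ ≡ g ⟨ a ⟩

  OpSet : Set ℓ → (m : Level) → Set (lsuc (ℓ ⊔ m))
  OpSet A m = (X : Set ℓ) → Pred (Operation A X) m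

  infix 4 _⊑_ _≋_
  _⊑_ : {A : Set ℓ} {m n : Level} → OpSet A m → OpSet A n → Set (lsuc ℓ ⊔ m ⊔ n)
  F ⊑ G = ∀ X → F X ⊆ G X

  _≋_ : {A : Set ℓ} {m n : Level} → OpSet A m → OpSet A n → Set (lsuc ℓ ⊔ m ⊔ n)
  F ≋ G = ∀ X → F X ≐ G X

  projection : {A X : Set ℓ} → X → Operation A X
  projection x = record { to = λ a → a x ; cong = λ a≗b → a≗b x }

  compose : {A X Y : Set ℓ} → Operation A Y → (Y → Operation A X) → Operation A X
  compose f g = record
    { to   = λ a → f ⟨ (λ y → g y ⟨ a ⟩) ⟩
    ; cong = λ a≗b → Func.cong f (λ y → Func.cong (g y) a≗b)
    }

  -- `resp` says that F is a set of operations up to their equality _≈_.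
  record IsClone {A : Set ℓ} {m : Level} (F : OpSet A m) : Set (lsuc ℓ ⊔ m) where
    field
      resp : ∀ {X} {f g : Operation A X} → f ≈ g → F X f → F X g
      proj : ∀ {X} (x : X) → F X (projection x)
      comp : ∀ {X Y} {f : Operation A Y} {g : Y → Operation A X} →
             F Y f → (∀ y → F X (g y)) → F X (compose f g)

  data Generated {A : Set ℓ} {m : Level} (G : OpSet A m) :
                 OpSet A (lsuc ℓ ⊔ m) where
    gen  : ∀ {X} {f : Operation A X} → G X f → Generated G X f
    resp : ∀ {X} {f g : Operation A X} → f ≈ g → Generated G X f → Generated G X g
    proj : ∀ {X} (x : X) → Generated G X (projection x)
    comp : ∀ {X Y} {f : Operation A Y} {g : Y → Operation A X} →
           Generated G Y f → (∀ y → Generated G X (g y)) →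
           Generated G X (compose f g)

  Generated-isClone : {A : Set ℓ} {m : Level} (G : OpSet A m) → IsClone (Generated G)
  Generated-isClone G = record { resp = resp ; proj = proj ; comp = comp }

  Generated-least : {A : Set ℓ} {m n : Level} {G : OpSet A m} {F : OpSet A n} →
                    IsClone F → G ⊑ F → Generated G ⊑ F
  Generated-least F-clone G⊑F X (gen Gf)     = G⊑F X Gf
  Generated-least F-clone G⊑F X (resp f≈g p) =
    IsClone.resp F-clone f≈g (Generated-least F-clone G⊑F X p)
  Generated-least F-clone G⊑F X (proj x)     = IsClone.proj F-clone x
  Generated-least F-clone G⊑F X (comp p q)   =
    IsClone.comp F-clone (Generated-least F-clone G⊑F _ p)
                         (λ y → Generated-least F-clone G⊑F X (q y))

  infix 4 _⊥_
  _⊥_ : {A X Y : Set ℓ} → Operation A X → Operation A Y → Set ℓ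
  _⊥_ {A} {X} {Y} f g = (a : X → Y → A) →
    g ⟨ (λ y → f ⟨ (λ x → a x y) ⟩) ⟩ ≡ f ⟨ (λ x → g ⟨ (λ y → a x y) ⟩) ⟩

  infix 10 _^⊥ _^⊥⊥
  _^⊥ : {A : Set ℓ} {m : Level} → OpSet A m → OpSet A (lsuc ℓ ⊔ m)
  _^⊥ {A} F X f = ∀ {Y} (g : Operation A Y) → F Y g → f ⊥ g

  _^⊥⊥ : {A : Set ℓ} {m : Level} → OpSet A m → OpSet A (lsuc ℓ ⊔ m)
  F ^⊥⊥ = (F ^⊥) ^⊥

module _ {ℓ : Level} {S : Set ℓ} (A : *-Set S) where
  open *-Set A

  basicOperation : S → Operation Carrier ⊤
  basicOperation s = record
    { to   = λ a → [ s ] · a tt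
    ; cong = λ a≗b → cong ([ s ] ·_) (a≗b tt)
    }

  -- The set Σ^A; a unary operation A → A is one of arity ⊤.
  data BasicOps : OpSet Carrier (lsuc ℓ) where
    basic : ∀ s {f : Operation Carrier ⊤} → f ≈ basicOperation s → BasicOps ⊤ f

  DerivedOps : OpSet Carrier (lsuc ℓ)
  DerivedOps = Generated BasicOps

{-# OPTIONS --safe #-}
-- Let A be free on Z, so that A ≅ S* × Z, and let g : A^Y → A lie in the double
-- centralizer.  Regard g as an element of the power A^(A^Y), alongside the
-- coordinate elements ρ_y = (x ↦ x y).  For every homomorphism f : A^(A^Y) → A,
-- commutation of g with f on the matrix of all ρ_y reads f(g) = g((f(ρ_y))_y),
-- so homomorphisms that agree on every ρ_y agree on g.  Factor g = w p with w as
-- long as possible, so that p is divisible by no s ∈ S.  Changing a homomorphism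
-- on the orbit S*p alone yields a homomorphism again, and the change is visible
-- at g; hence some ρ_y lies in S*p.  Since ρ_y takes a value in the basis, it is
-- indivisible too, which forces ρ_y = p and g = w ρ_y.
module Submission where

open import Defs
open import Level using (Level)
open import Axiom.ExcludedMiddle using (ExcludedMiddle)
open import Data.List.Base using (List; []; _∷_; _++_; [_])
open import Data.List.Properties using (++-assoc; ++-cancelˡ; ++-cancelʳ; ∷-injectiveˡ; ∷-injectiveʳ)
open import Data.Product.Base using (∃₂; ∃-syntax; _×_; _,_; proj₁; proj₂)
open import Data.Unit.Polymorphic.Base using (tt)
open import Function.Base using (_∘_; id)
open import Function.Bundles using (Func)
open import Relation.Binary.PropositionalEquality
  using (_≡_; _≢_; _≗_; refl; sym; trans; cong; cong₂; module ≡-Reasoning)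
open import Relation.Nullary using (¬_; yes; no; contradiction)

module _ {ℓ m : Level} {A : Set ℓ} (F : OpSet A m) where

  ^⊥-isClone : IsClone (F ^⊥)
  ^⊥-isClone = record
    { resp = λ {_} {f} {f′} f≈f′ f∈ g g∈ a →
        trans (Func.cong g (λ y → sym (f≈f′ _))) (trans (f∈ g g∈ a) (f≈f′ _))
    ; proj = λ _ _ _ _ → refl
    ; comp = λ {_} {_} {f} {h} f∈ h∈ g g∈ a →
        trans (f∈ g g∈ _) (Func.cong f (λ y → h∈ y g g∈ a))
    }

  ⊑-^⊥⊥ : F ⊑ F ^⊥⊥
  ⊑-^⊥⊥ X {f} f∈ g g∈ a = sym (g∈ f f∈ (λ y x → a x y))

module _ {ℓ : Level} {S : Set ℓ} (A : *-Set S) where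
  open *-Set A

  homomorphism-∈-^⊥ : ∀ {X} (f : Operation Carrier X) →
    (∀ s u → f ⟨ (λ x → [ s ] · u x) ⟩ ≡ [ s ] · f ⟨ u ⟩) → (BasicOps A ^⊥) X f
  homomorphism-∈-^⊥ f f-hom g (basic s g≈s) a = begin
    g ⟨ (λ y → f ⟨ (λ x → a x y) ⟩) ⟩  ≡⟨ g≈s _ ⟩
    [ s ] · f ⟨ (λ x → a x tt) ⟩       ≡⟨ f-hom s _ ⟨
    f ⟨ (λ x → [ s ] · a x tt) ⟩       ≡⟨ Func.cong f (λ x → g≈s _) ⟨
    f ⟨ (λ x → g ⟨ a x ⟩) ⟩            ∎
    where open ≡-Reasoning

  -- A normal form for derived operations: all basic operations are unary, so a composite still
  -- depends on a single coordinate.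
  translate : ∀ {X} → List S → X → Operation Carrier X
  translate w x = record { to = λ a → w · a x ; cong = λ a≗b → cong (w ·_) (a≗b x) }

  translate-derived : ∀ {X} w (x : X) → DerivedOps A X (translate w x)
  translate-derived []      x = resp (λ a → sym (identity (a x))) (proj x)
  translate-derived (s ∷ w) x =
    resp (λ a → sym (assoc [ s ] w (a x)))
         (comp {f = basicOperation A s} (gen (basic s (λ _ → refl)))
               (λ _ → translate-derived w x))

-- What the argument uses of A ≅ S* × Z: the S*-component, injectivity of translations, and one
-- element with empty word.
record Coordinates {ℓ : Level} {S : Set ℓ} (A : *-Set S) : Set ℓ where
  open *-Set A
  field
    word      : Carrier → List S
    word-·    : ∀ w a → word (w · a) ≡ w ++ word a
    ·-cancelˡ : ∀ w {a b} → w · a ≡ w · b → a ≡ b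
    base      : Carrier
    word-base : word base ≡ []

  ·-cancelʳ : ∀ v w a → v · a ≡ w · a → v ≡ w
  ·-cancelʳ v w a va≡wa = ++-cancelʳ (word a) v w
    (trans (sym (word-· v a)) (trans (cong word va≡wa) (word-· w a)))

  ∷-·-head : ∀ {s t v w a b} → (s ∷ v) · a ≡ (t ∷ w) · b → s ≡ t
  ∷-·-head {s} {t} {v} {w} {a} {b} eq = ∷-injectiveˡ
    (trans (sym (word-· (s ∷ v) a)) (trans (cong word eq) (word-· (t ∷ w) b)))

freeOn : {ℓ : Level} (S Z : Set ℓ) → *-Set S
freeOn S Z = record
  { Carrier  = List S × Z
  ; _·_      = λ { w (v , z) → w ++ v , z }
  ; identity = λ _ → refl
  ; assoc    = λ { v w (u , z) → cong (_, z) (++-assoc v w u) }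
  }

free⇒coordinates : {ℓ : Level} {S : Set ℓ} (A : *-Set S) → IsFree A →
                   *-Set.Carrier A → Coordinates A
free⇒coordinates {S = S} A (Z , η , free) a₀ = record
  { word      = word
  ; word-·    = λ w a → cong proj₁ (preserve w a)
  ; ·-cancelˡ = λ w {a} {b} wa≡wb →
      let w·to≡ = trans (sym (preserve w a)) (trans (cong to wa≡wb) (preserve w b))
      in to-injective (cong₂ _,_ (++-cancelˡ w _ _ (cong proj₁ w·to≡)) (cong proj₂ w·to≡))
  -- `a₀` shows that the basis is inhabited: its own `Z`-component is taken.
  ; base      = η (proj₂ (to a₀))
  ; word-base = cong proj₁ (proj₁ (proj₂ extension) (proj₂ (to a₀)))
  }
  where
  open *-Set A
  extension = free (freeOn S Z) ([] ,_)
  open Hom (proj₁ extension)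

  word : Carrier → List S
  word = proj₁ ∘ to

  from : List S × Z → Carrier
  from (w , z) = w · η z

  from∘to : Hom A A
  from∘to = record
    { to       = from ∘ to
    ; preserve = λ w a → trans (cong from (preserve w a)) (assoc w _ _)
    }

  identityHom : Hom A A
  identityHom = record { to = id ; preserve = λ _ _ → refl }

  -- Both `from ∘ to` and the identity are endomorphisms extending `η`, so uniqueness in the
  -- universal property identifies them.
  from-to : ∀ a → from (to a) ≡ a
  from-to a = trans
    (unique from∘to (λ z → trans (cong from (proj₁ (proj₂ extension) z)) (identity (η z))) a)
    (sym (unique identityHom (λ _ → refl) a))
    where unique = proj₂ (proj₂ (free A η))

  to-injective : ∀ {a b} → to a ≡ to b → a ≡ b
  to-injective {a} {b} eq = trans (sym (from-to a)) (trans (cong from eq) (from-to b))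

-- This will be applied with `X` the set A^Y of argument tuples. The coordinate `x₀` is where words
-- are read off.
module Power {ℓ : Level} (em : ExcludedMiddle ℓ) {S : Set ℓ} {A : *-Set S}
             (coordinates : Coordinates A) {X : Set ℓ} (x₀ : X) where
  open *-Set A
  open Coordinates coordinates

  infixr 6 _•_
  _•_ : List S → (X → Carrier) → X → Carrier
  (w • u) x = w · u x

  Indivisible : (X → Carrier) → Set ℓ
  Indivisible p = ∀ s u → ¬ (p ≗ [ s ] • u)

  -- Each division by a letter removes that letter from the word of the value at `x₀`, so the
  -- process ends; `v` is this word, serving as the measure.
  factor : ∀ u → ∃[ w ] ∃[ p ] u ≗ w • p × Indivisible p
  factor u = go (word (u x₀)) u refl
    where
    go : ∀ v u → word (u x₀) ≡ v → ∃[ w ] ∃[ p ] u ≗ w • p × Indivisible p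
    go v u eq with em {P = ∃₂ λ s u′ → u ≗ [ s ] • u′}
    ... | no u-indivisible =
      [] , u , (λ x → sym (identity (u x))) , λ s u′ e → u-indivisible (s , u′ , e)
    ... | yes (s , u′ , u≗su′) with v
                               | trans (sym eq) (trans (cong word (u≗su′ x₀)) (word-· [ s ] (u′ x₀)))
    ...   | []     | ()
    ...   | t ∷ v′ | tv′≡ with go v′ u′ (sym (∷-injectiveʳ tv′≡))
    ...     | w , p , u′≗wp , p-indivisible =
      s ∷ w , p ,
      (λ x → trans (u≗su′ x) (trans (cong ([ s ] ·_) (u′≗wp x)) (sym (assoc [ s ] w (p x))))) ,
      p-indivisible

  indivisible-orbit : ∀ {p u} w → Indivisible u → u ≗ w • p → u ≗ p
  indivisible-orbit         []      _             u≗p  x = trans (u≗p x) (identity _)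
  indivisible-orbit {p = p} (s ∷ w) u-indivisible u≗wp x =
    contradiction (λ x → trans (u≗wp x) (assoc [ s ] w (p x))) (u-indivisible s (w • p))

  InOrbit : (p u : X → Carrier) → Set ℓ
  InOrbit p u = ∃[ w ] u ≗ w • p

  orbit-· : ∀ {p u} s → InOrbit p u → InOrbit p ([ s ] • u)
  orbit-· {p} s (w , u≗wp) =
    s ∷ w , λ x → trans (cong ([ s ] ·_) (u≗wp x)) (sym (assoc [ s ] w (p x)))

  -- If `[ s ] • u` is `p` itself, then `p` is divisible; otherwise the word taking `p` to it starts
  -- with `s`, which cancels. Thus the complement of the orbit is closed under the action.
  orbit-·⁻¹ : ∀ {p u} s → Indivisible p → InOrbit p ([ s ] • u) → InOrbit p u
  orbit-·⁻¹ {p} {u} s p-indivisible ([] , su≗p) =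
    contradiction (λ x → sym (trans (su≗p x) (identity (p x)))) (p-indivisible s u)
  orbit-·⁻¹ {p} {u} s _ (t ∷ w , su≗twp)
    with refl ← ∷-·-head {w = w} (su≗twp x₀) =
    w , λ x → ·-cancelˡ [ s ] (trans (su≗twp x) (assoc [ s ] w (p x)))

  -- Evaluation at `x₀`, altered on the orbit of `p` so that `p` goes to `q`.
  module Redirect (p : X → Carrier) (p-indivisible : Indivisible p) (q : Carrier) where

    redirect : (X → Carrier) → Carrier
    redirect u with em {P = InOrbit p u}
    ... | yes (w , _) = w · q
    ... | no _        = u x₀

    -- The word that excluded middle supplies need not be `w` a priori; right cancellation at `x₀`
    -- makes them equal.
    redirect-orbit : ∀ {u} w → u ≗ w • p → redirect u ≡ w · q
    redirect-orbit {u} w u≗wp with em {P = InOrbit p u}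
    ... | yes (v , u≗vp) =
      cong (_· q) (·-cancelʳ v w (p x₀) (trans (sym (u≗vp x₀)) (u≗wp x₀)))
    ... | no u∉          = contradiction (w , u≗wp) u∉

    redirect-off-orbit : ∀ {u} → ¬ InOrbit p u → redirect u ≡ u x₀
    redirect-off-orbit {u} u∉ with em {P = InOrbit p u}
    ... | yes u∈ = contradiction u∈ u∉
    ... | no _   = refl

    redirect-cong : ∀ {u v} → u ≗ v → redirect u ≡ redirect v
    redirect-cong {u} {v} u≗v with em {P = InOrbit p u}
    ... | yes (w , u≗wp) = sym (redirect-orbit w (λ x → trans (sym (u≗v x)) (u≗wp x)))
    ... | no u∉          = trans (u≗v x₀) (sym (redirect-off-orbit
      λ (w , v≗wp) → u∉ (w , λ x → trans (u≗v x) (v≗wp x))))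

    -- The orbit of `p` and its complement are both stable under letters, so the two branches never
    -- mix.
    redirect-homomorphism : ∀ s u → redirect ([ s ] • u) ≡ [ s ] · redirect u
    redirect-homomorphism s u with em {P = InOrbit p u}
    ... | yes u∈@(w , _) =
      trans (redirect-orbit (s ∷ w) (proj₂ (orbit-· s u∈))) (assoc [ s ] w q)
    ... | no u∉          = redirect-off-orbit (u∉ ∘ orbit-·⁻¹ s p-indivisible)

    redirection : Operation Carrier X
    redirection = record { to = redirect ; cong = redirect-cong }

∃-≢ : {ℓ : Level} → ExcludedMiddle ℓ → {A : Set ℓ} →
      (∃₂ λ (a b : A) → a ≢ b) → ∀ c → ∃[ d ] d ≢ c
∃-≢ em (a , b , a≢b) c with em {P = a ≡ c}
... | no a≢c  = a , a≢c
... | yes a≡c = b , λ b≡c → a≢b (trans a≡c (sym b≡c))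

⊥⊥⇒translate : {ℓ : Level} → ExcludedMiddle ℓ → {S : Set ℓ} (A : *-Set S) →
  Coordinates A → (∃₂ λ (a b : *-Set.Carrier A) → a ≢ b) →
  ∀ {Y} (g : Operation (*-Set.Carrier A) Y) → (BasicOps A ^⊥⊥) Y g →
  ∃₂ λ w y → translate A w y ≈ g
⊥⊥⇒translate {ℓ} em A coordinates distinct {Y} g g∈ = result
  where
  open *-Set A
  open Coordinates coordinates
  open ≡-Reasoning

  -- At this tuple every `ρ y` takes the value `base`, whose word is empty.
  x₀ : Y → Carrier
  x₀ _ = base

  open Power em coordinates x₀

  ρ : Y → (Y → Carrier) → Carrier
  ρ y x = x y

  ρ-indivisible : ∀ y → Indivisible (ρ y)
  ρ-indivisible y s u ρ≗su
    with () ← trans (sym word-base) (trans (cong word (ρ≗su x₀)) (word-· [ s ] (u x₀)))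

  result : ∃₂ λ w y → translate A w y ≈ g
  result with factor (g ⟨_⟩)
  ... | w , p , g≗wp , p-indivisible with em {P = ∃[ y ] ρ y ≗ p}
  ...   | yes (y , ρ≗p) = w , y , λ a → trans (cong (w ·_) (ρ≗p a)) (sym (g≗wp a))
  -- With `q` different from `p x₀`, redirection and evaluation at `x₀` disagree at `p`, yet they
  -- agree on every `ρ y`.
  ...   | no p-no-ρ with q , q≢p ← ∃-≢ em distinct (p x₀) =
    contradiction (·-cancelˡ w wq≡wp) q≢p
    where
    open Redirect p p-indivisible q

    redirect-ρ : ∀ y → redirect (ρ y) ≡ base
    redirect-ρ y = redirect-off-orbit
      λ (v , ρ≗vp) → p-no-ρ (y , indivisible-orbit v (ρ-indivisible y) ρ≗vp)

    wq≡wp : w · q ≡ w · p x₀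
    wq≡wp = begin
      w · q                           ≡⟨ redirect-orbit w g≗wp ⟨
      redirect (g ⟨_⟩)                ≡⟨ g∈ redirection
                                           (homomorphism-∈-^⊥ A redirection redirect-homomorphism) ρ ⟩
      g ⟨ (λ y → redirect (ρ y)) ⟩    ≡⟨ Func.cong g redirect-ρ ⟩
      -- Here `x₀` changes role: the tuple of values of the `ρ y` is again `x₀`, so `g` of it is the
      -- `x₀`-coordinate of `g`.
      g ⟨ x₀ ⟩                        ≡⟨ g≗wp x₀ ⟩
      w · p x₀                        ∎

theorem9p8 : {ℓ : Level} → ExcludedMiddle ℓ →
    (S : Set ℓ) (A : *-Set S) → IsFree A →
    (∃₂ λ (a b : *-Set.Carrier A) → a ≢ b) →
    BasicOps A ^⊥⊥ ≋ DerivedOps A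
theorem9p8 em S A free distinct X = ⊥⊥⊆derived , derived⊆⊥⊥
  where
  ⊥⊥⊆derived : ∀ {g} → (BasicOps A ^⊥⊥) X g → DerivedOps A X g
  ⊥⊥⊆derived {g} g∈
    with w , x , eq ← ⊥⊥⇒translate em A (free⇒coordinates A free (proj₁ distinct)) distinct g g∈ =
    resp eq (translate-derived A w x)

  derived⊆⊥⊥ : ∀ {g} → DerivedOps A X g → (BasicOps A ^⊥⊥) X g
  derived⊆⊥⊥ = Generated-least (^⊥-isClone (BasicOps A ^⊥)) (⊑-^⊥⊥ (BasicOps A)) X
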